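{- Let $k\ge1$ and $\ell$ be integers with $0\le\ell\le k$, and let $G=(V,E)$ be a $(k,\ell)$-tight hypergraph of dimension $s$ with $\ell\le sk-1$. Then the edge multiset $E$ can be partitioned into $E_1$ and $E_2$ such that $(V,E_1)$ is an $\ell$-arborescence and $(V,E_2)$ is a $(k-\ell)$-map.
   Context: A hypergraph $G=(V,E)$ consists of a finite vertex set $V$ and a finite multiset $E$ of nonempty subsets of $V$ (edges; parallel copies allowed, edges of size one are loops). The dimension of an edge $e$ is $|e|$; the dimension of $G$ is the minimum edge dimension. For $V'\subseteq V$, $E(V')$ is the multiset of edges contained in $V'$. $G$ is $(k,\ell)$-sparse if $|E(V')|\le k|V'|-\ell$ for every $V'\subseteq V$ with $E(V')$ nonempty, and $(k,\ell)$-tight if it is $(k,\ell)$-sparse and $|E|=k|V|-\ell$. A hypergraph $(V,T)$ is $1$-partition connected if for every partition of $V$ into $t$ nonempty parts at least $t-1$ edges of $T$ meet at least two parts; a tree is a hypergraph $(V,T)$ that is $1$-partition connected while no $(V,T\setminus\{f\})$, $f\in T$, is. A $j$-arborescence is a hypergraph $(V,E')$ whose edge multiset can be partitioned into $j$ sub-multisets each forming a tree on $V$ (for $j=0$, the edge multiset is empty). An orientation assigns to each edge one of its vertices (its tail). A map is a hypergraph $(V,M)$ admitting an orientation in which every vertex is the tail of exactly one edge; a $j$-map is a hypergraph $(V,E')$ whose edge multiset can be partitioned into $j$ sub-multisets each forming a map on $V$ (for $j=0$, empty). -}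

module Defs where

open import Data.Nat using (ℕ; zero; suc; _+_; _*_; _∸_; _≤_)
open import Data.Bool using (Bool; true; false; _∧_; not)
open import Data.Fin using (Fin; _≟_)
open import Data.Fin.Subset using (Subset; _∈_; _⊆_; Nonempty; ∣_∣)
open import Data.Fin.Subset.Properties using (_⊆?_)
open import Data.Bool.ListAction using (any)
open import Data.List using (List; []; _∷_; length; allFin; removeAt; _++_; concat)
open import Data.List.Relation.Unary.All using (All)
open import Data.List.Relation.Unary.Any using (Any)
open import Data.List.Relation.Binary.Permutation.Propositional using (_↭_)
open import Data.Vec using (Vec; lookup; toList)
open import Data.Product using (Σ; ∃; _×_)
open import Function using (Surjective)
open import Relation.Nullary using (¬_)
open import Relation.Nullary.Decidable using (⌊_⌋)
open import Relation.Binary.PropositionalEquality using (_≡_)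

-- Vertex set V = Fin n.  An edge is a subset of Fin n; the edge multiset is a
-- list of subsets (parallel copies allowed).  Hypergraph edges must be nonempty.
Edges : ℕ → Set
Edges n = List (Subset n)

IsHypergraph : ∀ {n} → Edges n → Set
IsHypergraph E = All Nonempty E

count : ∀ {A : Set} → (A → Bool) → List A → ℕ
count f []       = 0
count f (x ∷ xs) with f x
... | true  = suc (count f xs)
... | false = count f xs

edgesIn : ∀ {n} → Subset n → Edges n → ℕ
edgesIn V' E = count (λ e → ⌊ e ⊆? V' ⌋) E

HasDimension : ∀ {n} → Edges n → ℕ → Set
HasDimension E s = All (λ e → s ≤ ∣ e ∣) E × Any (λ e → ∣ e ∣ ≡ s) E

-- (k,ℓ)-sparse : |E(V')| ≤ k|V'| - ℓ whenever E(V') nonempty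
-- (written additively in ℕ: |E(V')| + ℓ ≤ k|V'|, equivalent over ℤ)
Sparse : ∀ {n} → ℕ → ℕ → Edges n → Set
Sparse {n} k ℓ E = (V' : Subset n) → 1 ≤ edgesIn V' E → edgesIn V' E + ℓ ≤ k * ∣ V' ∣

Tight : ∀ {n} → ℕ → ℕ → Edges n → Set
Tight {n} k ℓ E = Sparse k ℓ E × (length E + ℓ ≡ k * n)

meetsTwo : ∀ {n t} → (Fin n → Fin t) → Subset n → Bool
meetsTwo {n} p e =
  any (λ u → any (λ v → lookup e u ∧ lookup e v ∧ not ⌊ p u ≟ p v ⌋) (allFin n)) (allFin n)

-- 1-partition connected: for every partition of V into t nonempty parts
-- (a surjection p : V → Fin t), at least t-1 edges meet two or more parts.
PartitionConnected : ∀ {n} → Edges n → Set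
PartitionConnected {n} T =
  (t : ℕ) (p : Fin n → Fin t) → Surjective _≡_ _≡_ p →
  t ∸ 1 ≤ count (meetsTwo p) T

IsTree : ∀ {n} → Edges n → Set
IsTree T = PartitionConnected T × ((i : Fin (length T)) → ¬ PartitionConnected (removeAt T i))

IsArborescence : ∀ {n} → ℕ → Edges n → Set
IsArborescence {n} j E' = Σ (Vec (Edges n) j) λ Ts → (concat (toList Ts) ↭ E') × All IsTree (toList Ts)

IsMap : ∀ {n} → Edges n → Set
IsMap {n} M =
  Σ (Fin (length M) → Fin n) λ tail →
    ((i : Fin (length M)) → tail i ∈ Data.List.lookup M i) ×
    ((v : Fin n) → Σ (Fin (length M)) λ i → (tail i ≡ v) × ((j : Fin (length M)) → tail j ≡ v → j ≡ i))

IsJMap : ∀ {n} → ℕ → Edges n → Set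
IsJMap {n} j E' = Σ (Vec (Edges n) j) λ Ms → (concat (toList Ms) ↭ E') × All IsMap (toList Ms)

{-# OPTIONS --safe #-}

-- Fix a root r.  Hakimi's criterion and sparsity orient G with indegree k at
-- every vertex except r, and k − ℓ at r.  Every nonempty X avoiding r then has at
-- least k|X| − |E(X)| ≥ ℓ entering edges, so Edmonds' branching theorem (with
-- Lovász's proof) extracts ℓ edge-disjoint spanning branchings rooted at r,
-- which are trees.  What remains has indegree k − ℓ everywhere, so it splits
-- into k − ℓ maps.

module Submission where

open import Defs
open import Data.Bool using (Bool; true; false; T; T?)
open import Data.Bool.Properties using (T-≡; T-∧)
open import Data.Empty using (⊥-elim) renaming (⊥ to Empty)
open import Data.Fin using (Fin; zero; suc; _≟_)
open import Data.Fin.Properties using (any?; injective⇒≤; suc-injective)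
open import Data.Fin.Subset using (Subset; inside; outside; ⊤; ⊥; ⁅_⁆; _∩_; _∪_; _∈_; _∉_; _⊆_; _⊂_; _⊈_; Nonempty; ∣_∣)
open import Data.Fin.Subset.Properties using (_∈?_; _⊆?_; nonempty?; anySubset?; ∈⊤; ∉⊥; p∩q⊆p; p∩q⊆q; p⊆p∪q; q⊆p∪q; x∈p∩q⁺; x∈p∩q⁻; x∈p∪q⁻; p⊂q⇒∣p∣<∣q∣; drop-there; x∈p⇒∣p-x∣<∣p∣; x∈⁅x⁆; x∈⁅y⁆⇒x≡y; ⊆-antisym)
open import Data.List using (List; []; _∷_; _++_; allFin; concat; filter; length; lookup; map; replicate; removeAt; tabulate)
open import Data.List.Membership.DecPropositional using () renaming (_∈?_ to mem?)
open import Data.List.Membership.Propositional using (lose) renaming (_∈_ to _∈ˡ_; _∉_ to _∉ˡ_)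
open import Data.List.Membership.Propositional.Properties using (∈-∃++; ∈-allFin; ∈-tabulate⁺; ∈-tabulate⁻; ∈-map⁺; ∈-filter⁺)
open import Data.List.Properties using (length-map; length-++; length-removeAt′; length-tabulate; length-filter; ∷-injective; map-++; map-tabulate; ++-assoc)
open import Data.List.Relation.Binary.Permutation.Propositional using (_↭_; refl; prep; swap; trans; ↭-sym; ↭-reflexive; ↭⇒↭ₛ; module PermutationReasoning)
open import Data.List.Relation.Binary.Permutation.Propositional.Properties using (shift; map⁺; ↭-map-inv; ↭-length; drop-∷; ∈-resp-↭; ++⁺ˡ; ++⁺ʳ)
import Data.List.Relation.Binary.Permutation.Setoid.Properties as ↭ₛ
open import Data.List.Relation.Unary.All as All using (All; []; _∷_)
open import Data.List.Relation.Unary.AllPairs using ([]; _∷_)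
open import Data.List.Relation.Unary.Any as Any using (here; there)
open import Data.List.Relation.Unary.Any.Properties using (any⁺; lookup-index)
open import Data.List.Relation.Unary.Unique.Propositional using (Unique)
import Data.List.Relation.Unary.Unique.Propositional.Properties as Unique
open import Data.Nat using (ℕ; zero; suc; _+_; _*_; _≤_; _<_; _∸_; z≤n; s≤s; _≤?_)
open import Data.Nat.Induction using (<-wellFounded)
open import Data.Nat.Properties hiding (_≟_; _≤?_) renaming (suc-injective to suc-injectiveℕ)
open import Algebra.Properties.CommutativeSemigroup +-commutativeSemigroup using (interchange; x∙yz≈y∙xz; xy∙z≈xz∙y)
open import Data.Product using (Σ; ∃; ∃₂; _×_; _,_; proj₁; proj₂)
open import Data.Sum using (_⊎_; inj₁; inj₂; [_,_]′)
open import Data.Vec using (Vec; []; _∷_; toList; here; there)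
import Data.Vec as Vec
open import Data.Vec.Properties using ([]=⇒lookup; lookup⇒[]=; lookup∘tabulate)
open import Function using (Equivalence; _∘_; id; case_of_)
open import Induction.WellFounded using (Acc; acc)
open import Relation.Binary.PropositionalEquality as ≡ using (_≡_; _≢_; refl; cong; cong₂; subst; sym)
import Relation.Binary.PropositionalEquality.Properties as ≡
open import Relation.Nullary using (Dec; yes; no; ¬_; contradiction; ¬?; _×-dec_)
open import Relation.Nullary.Decidable using (⌊_⌋; decidable-stable; fromWitness; fromWitnessFalse; toWitness)
open import Relation.Unary using (Decidable)


-- Counting the elements of a list that satisfy a decidable predicate

⟦_⟧ : ∀ {P : Set} → Dec P → ℕ
⟦ yes _ ⟧ = 1
⟦ no  _ ⟧ = 0

# : ∀ {A : Set} {P : A → Set} → Decidable P → List A → ℕ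
# P? = count (λ x → ⌊ P? x ⌋)

-- Adds nothing to any count, so inequalities between two pairs of predicates specialise to fewer
-- predicates.
never? : ∀ {A : Set} → Decidable {A = A} (λ _ → Empty)
never? _ = no id

#-∷ : ∀ {A : Set} {P : A → Set} (P? : Decidable P) x xs → # P? (x ∷ xs) ≡ ⟦ P? x ⟧ + # P? xs
#-∷ P? x xs with P? x
... | yes _ = refl
... | no  _ = refl

-- Uncrossing for indicators. Summed over a list it yields the sub- and supermodular inequalities
-- for edges, heads and entering arcs, as well as plain subadditivity.
⟦⟧-submodular : ∀ {P Q R S : Set} (P? : Dec P) (Q? : Dec Q) (R? : Dec R) (S? : Dec S) →
  (P → R ⊎ S) → (Q → R ⊎ S) → (P → Q → R × S) → ⟦ P? ⟧ + ⟦ Q? ⟧ ≤ ⟦ R? ⟧ + ⟦ S? ⟧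
⟦⟧-submodular (yes p) (yes q) (yes _) (yes _) _ _ _ = ≤-refl
⟦⟧-submodular (yes p) (yes q) (no ¬r) _       _ _ f = contradiction (proj₁ (f p q)) ¬r
⟦⟧-submodular (yes p) (yes q) (yes _) (no ¬s) _ _ f = contradiction (proj₂ (f p q)) ¬s
⟦⟧-submodular (no _)  (no _)  _       _       _ _ _ = z≤n
⟦⟧-submodular (yes _) (no _)  (yes _) _       _ _ _ = s≤s z≤n
⟦⟧-submodular (yes _) (no _)  (no _)  (yes _) _ _ _ = ≤-refl
⟦⟧-submodular (yes p) (no _)  (no ¬r) (no ¬s) f _ _ = ⊥-elim ([ ¬r , ¬s ]′ (f p))
⟦⟧-submodular (no _)  (yes _) (yes _) _       _ _ _ = s≤s z≤n
⟦⟧-submodular (no _)  (yes _) (no _)  (yes _) _ _ _ = ≤-refl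
⟦⟧-submodular (no _)  (yes q) (no ¬r) (no ¬s) _ f _ = ⊥-elim ([ ¬r , ¬s ]′ (f q))

module _ {A : Set} {P Q : A → Set} (P? : Decidable P) (Q? : Decidable Q) where

  #-submodular : ∀ {R S : A → Set} (R? : Decidable R) (S? : Decidable S) →
    (∀ x → P x → R x ⊎ S x) → (∀ x → Q x → R x ⊎ S x) → (∀ x → P x → Q x → R x × S x) →
    ∀ xs → # P? xs + # Q? xs ≤ # R? xs + # S? xs
  #-submodular R? S? f g h [] = z≤n
  #-submodular R? S? f g h (x ∷ xs)
    rewrite #-∷ P? x xs | #-∷ Q? x xs | #-∷ R? x xs | #-∷ S? x xs = begin
      (⟦ P? x ⟧ + # P? xs) + (⟦ Q? x ⟧ + # Q? xs) ≡⟨ interchange ⟦ P? x ⟧ _ _ _ ⟩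
      (⟦ P? x ⟧ + ⟦ Q? x ⟧) + (# P? xs + # Q? xs) ≤⟨ +-mono-≤ (⟦⟧-submodular (P? x) (Q? x) (R? x) (S? x) (f x) (g x) (h x))
                                                              (#-submodular R? S? f g h xs) ⟩
      (⟦ R? x ⟧ + ⟦ S? x ⟧) + (# R? xs + # S? xs) ≡⟨ interchange ⟦ R? x ⟧ _ _ _ ⟩
      (⟦ R? x ⟧ + # R? xs) + (⟦ S? x ⟧ + # S? xs) ∎
    where
    open ≤-Reasoning

  #-<-witness : ∀ xs → # P? xs < # Q? xs → ∃ λ x → x ∈ˡ xs × Q x × ¬ P x
  #-<-witness (x ∷ xs) lt with P? x | Q? x
  ... | no ¬p | yes q = x , here refl , q , ¬p
  ... | yes _ | yes _ = let y , y∈ , q = #-<-witness xs (≤-pred lt) in y , there y∈ , q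
  ... | yes _ | no  _ = let y , y∈ , q = #-<-witness xs (<-trans (n<1+n _) lt) in y , there y∈ , q
  ... | no  _ | no  _ = let y , y∈ , q = #-<-witness xs lt in y , there y∈ , q

module _ {A : Set} {P : A → Set} (P? : Decidable P) where

  #-yes : ∀ {x} xs → P x → # P? (x ∷ xs) ≡ suc (# P? xs)
  #-yes {x} xs p with P? x
  ... | yes _ = refl
  ... | no ¬p = contradiction p ¬p

  #-no : ∀ {x} xs → ¬ P x → # P? (x ∷ xs) ≡ # P? xs
  #-no {x} xs ¬p with P? x
  ... | yes p = contradiction p ¬p
  ... | no  _ = refl

  #-∷-≤ : ∀ x xs → # P? xs ≤ # P? (x ∷ xs)
  #-∷-≤ x xs = ≤-trans (m≤n+m _ ⟦ P? x ⟧) (≤-reflexive (sym (#-∷ P? x xs)))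

  #-none : (∀ x → ¬ P x) → ∀ xs → # P? xs ≡ 0
  #-none ¬P []       = refl
  #-none ¬P (x ∷ xs) = ≡.trans (#-no xs (¬P x)) (#-none ¬P xs)

  #-↭ : ∀ {xs ys} → xs ↭ ys → # P? xs ≡ # P? ys
  #-↭ refl = refl
  #-↭ (prep {xs} {ys} x p) rewrite #-∷ P? x xs | #-∷ P? x ys = cong (⟦ P? x ⟧ +_) (#-↭ p)
  #-↭ (swap {xs} {ys} x y p)
    rewrite #-∷ P? x (y ∷ xs) | #-∷ P? y xs | #-∷ P? y (x ∷ ys) | #-∷ P? x ys | #-↭ p
    = x∙yz≈y∙xz ⟦ P? x ⟧ ⟦ P? y ⟧ (# P? ys)
  #-↭ (trans p q) = ≡.trans (#-↭ p) (#-↭ q)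

  #-++ : ∀ xs ys → # P? (xs ++ ys) ≡ # P? xs + # P? ys
  #-++ []       ys = refl
  #-++ (x ∷ xs) ys with P? x
  ... | yes _ = cong suc (#-++ xs ys)
  ... | no  _ = #-++ xs ys

  #-copies : ∀ j xs → # P? (concat (replicate j xs)) ≡ j * # P? xs
  #-copies zero    xs = refl
  #-copies (suc j) xs = ≡.trans (#-++ xs _) (cong (# P? xs +_) (#-copies j xs))

module _ {A : Set} {P Q : A → Set} (P? : Decidable P) (Q? : Decidable Q) where

  #-cover : ∀ {R : A → Set} (R? : Decidable R) → (∀ x → P x → Q x ⊎ R x) → ∀ xs → # P? xs ≤ # Q? xs + # R? xs
  #-cover R? f xs = ≤-trans (m≤m+n _ (# never? xs))
    (#-submodular P? never? Q? R? f (λ _ ()) (λ _ _ ()) xs)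

  #-mono : (∀ x → P x → Q x) → ∀ xs → # P? xs ≤ # Q? xs
  #-mono f xs = ≤-trans (#-cover never? (λ x → inj₁ ∘ f x) xs)
    (≤-reflexive (≡.trans (cong (# Q? xs +_) (#-none never? (λ _ ()) xs)) (+-identityʳ _)))

count-map : ∀ {A B : Set} (f : B → Bool) (g : A → B) xs → count f (map g xs) ≡ count (f ∘ g) xs
count-map f g []       = refl
count-map f g (x ∷ xs) with f (g x)
... | true  = cong suc (count-map f g xs)
... | false = count-map f g xs

count≡length-filter : ∀ {A : Set} (f : A → Bool) xs → count f xs ≡ length (filter (T? ∘ f) xs)
count≡length-filter f []       = refl
count≡length-filter f (x ∷ xs) with f x
... | true  = cong suc (count≡length-filter f xs)
... | false = count≡length-filter f xs

count≤length : ∀ {A : Set} (f : A → Bool) xs → count f xs ≤ length xs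
count≤length f xs = ≤-trans (≤-reflexive (count≡length-filter f xs)) (length-filter (T? ∘ f) xs)

-- Distinct elements have distinct positions, since looking a position up returns its element.
enumeration-length : ∀ {t} (xs : List (Fin t)) → (∀ i → i ∈ˡ xs) → t ≤ length xs
enumeration-length xs all∈ = injective⇒≤ {f = λ i → Any.index (all∈ i)} λ {i} {j} eq → begin
  i                               ≡⟨ lookup-index (all∈ i) ⟩
  lookup xs (Any.index (all∈ i)) ≡⟨ cong (lookup xs) eq ⟩
  lookup xs (Any.index (all∈ j)) ≡⟨ lookup-index (all∈ j) ⟨
  j                               ∎
  where open ≡.≡-Reasoning

-- The elements passing `f`, sent through `g`, reach every index apart perhaps from `i₀`; adjoining
-- `i₀` accounts for the one subtracted from `t`.
count-≥ : ∀ {A : Set} {t} (f : A → Bool) (g : A → Fin t) (i₀ : Fin t) xs →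
  (∀ i → i ≢ i₀ → ∃ λ x → x ∈ˡ xs × T (f x) × g x ≡ i) → t ∸ 1 ≤ count f xs
count-≥ {t = t} f g i₀ xs hit = begin
  t ∸ 1                            ≤⟨ ∸-monoˡ-≤ 1 (enumeration-length (i₀ ∷ map g (filter (T? ∘ f) xs)) all∈) ⟩
  length (map g (filter (T? ∘ f) xs)) ≡⟨ length-map g (filter (T? ∘ f) xs) ⟩
  length (filter (T? ∘ f) xs)      ≡⟨ count≡length-filter f xs ⟨
  count f xs                       ∎
  where
  open ≤-Reasoning
  all∈ : ∀ i → i ∈ˡ i₀ ∷ map g (filter (T? ∘ f) xs)
  all∈ i with i ≟ i₀
  ... | yes refl = here refl
  ... | no i≢i₀ with x , x∈ , fx , refl ← hit i i≢i₀ = there (∈-map⁺ g (∈-filter⁺ (T? ∘ f) x∈ fx))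

-- Lists and subsets

∈⇒↭∷ : ∀ {A : Set} {x : A} {xs} → x ∈ˡ xs → ∃ λ ys → xs ↭ x ∷ ys
∈⇒↭∷ x∈xs with ys , zs , refl ← ∈-∃++ x∈xs = ys ++ zs , shift _ ys zs

++-cancelˡ-↭ : ∀ {A : Set} (xs : List A) {ys zs} → xs ++ ys ↭ xs ++ zs → ys ↭ zs
++-cancelˡ-↭ []       p = p
++-cancelˡ-↭ (x ∷ xs) p = ++-cancelˡ-↭ xs (drop-∷ p)

Unique-resp-↭ : ∀ {A : Set} {xs ys : List A} → xs ↭ ys → Unique xs → Unique ys
Unique-resp-↭ p = ↭ₛ.Unique-resp-↭ (≡.setoid _) (↭⇒↭ₛ p)

map≡++⁻ : ∀ {A B : Set} (f : A → B) xs {ys zs} → map f xs ≡ ys ++ zs →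
  ∃₂ λ us vs → xs ≡ us ++ vs × map f us ≡ ys × map f vs ≡ zs
map≡++⁻ f xs       {[]}     eq = [] , xs , refl , refl , eq
map≡++⁻ f (x ∷ xs) {y ∷ ys} eq with refl , eq′ ← ∷-injective eq
  with us , vs , refl , refl , refl ← map≡++⁻ f xs {ys} eq′ = x ∷ us , vs , refl , refl , refl

module _ {n : ℕ} where

  ⊈⇒∃ : ∀ {p q : Subset n} → p ⊈ q → ∃ λ x → x ∈ p × x ∉ q
  ⊈⇒∃ {p} {q} p⊈q with any? (λ x → (x ∈? p) ×-dec ¬? (x ∈? q))
  ... | yes w = w
  ... | no ¬w = contradiction (λ {x} x∈p → decidable-stable (x ∈? q) (λ x∉q → ¬w (x , x∈p , x∉q))) p⊈q

  comprehension : ∀ {P : Fin n → Set} → Decidable P → Subset n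
  comprehension P? = Vec.tabulate (λ x → ⌊ P? x ⌋)

  module _ {P : Fin n → Set} (P? : Decidable P) {x : Fin n} where

    ∈-comprehension⁺ : P x → x ∈ comprehension P?
    ∈-comprehension⁺ p = lookup⇒[]= x _ (≡.trans (lookup∘tabulate _ x) (Equivalence.to T-≡ (fromWitness p)))

    ∈-comprehension⁻ : x ∈ comprehension P? → P x
    ∈-comprehension⁻ x∈ = toWitness (Equivalence.from T-≡ (≡.trans (sym (lookup∘tabulate _ x)) ([]=⇒lookup x∈)))

-- Orientations with prescribed indegrees

-- An oriented edge. The chosen vertex is called the head, as is usual for branchings; it becomes
-- the tail in `IsMap`.
record Arc (n : ℕ) : Set where
  constructor arc
  field
    edge      : Subset n
    head      : Fin n
    head∈edge : head ∈ edge

open Arc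

module _ {n : ℕ} where

  #⊆-supermodular : ∀ (A B : Subset n) E → # (_⊆? A) E + # (_⊆? B) E ≤ # (_⊆? (A ∪ B)) E + # (_⊆? (A ∩ B)) E
  #⊆-supermodular A B = #-submodular (_⊆? A) (_⊆? B) (_⊆? (A ∪ B)) (_⊆? (A ∩ B))
    (λ e e⊆A → inj₁ (λ {_} x → p⊆p∪q B (e⊆A x))) (λ e e⊆B → inj₁ (λ {_} x → q⊆p∪q A B (e⊆B x)))
    (λ e e⊆A e⊆B → (λ {_} x → p⊆p∪q B (e⊆A x)) , (λ {_} x → x∈p∩q⁺ (e⊆A x , e⊆B x)))

  #∈-submodular : ∀ (A B : Subset n) M → # (_∈? (A ∪ B)) M + # (_∈? (A ∩ B)) M ≤ # (_∈? A) M + # (_∈? B) M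
  #∈-submodular A B = #-submodular (_∈? (A ∪ B)) (_∈? (A ∩ B)) (_∈? A) (_∈? B)
    (λ x → x∈p∪q⁻ A B) (λ x → inj₁ ∘ p∩q⊆p A B) (λ x _ → x∈p∩q⁻ A B)

  -- M lists the heads still to be used, with multiplicity: # (_∈? X) M is the total indegree demanded in X.
  HakimiCondition : Edges n → List (Fin n) → Set
  HakimiCondition E M = ∀ X → # (_⊆? X) E ≤ # (_∈? X) M

  -- Uncrossing of tight sets, those whose demand is used up by the edges inside them. The
  -- intersection satisfies the condition, so supermodularity of the edge count leaves no slack at
  -- the union.
  tight-∪ : ∀ E M → HakimiCondition E M → ∀ A B →
    # (_∈? A) M ≤ # (_⊆? A) E → # (_∈? B) M ≤ # (_⊆? B) E → # (_∈? (A ∪ B)) M ≤ # (_⊆? (A ∪ B)) E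
  tight-∪ E M hyp A B tA tB = +-cancelʳ-≤ (# (_∈? (A ∩ B)) M) _ _ (begin
    # (_∈? (A ∪ B)) M + # (_∈? (A ∩ B)) M ≤⟨ #∈-submodular A B M ⟩
    # (_∈? A) M + # (_∈? B) M             ≤⟨ +-mono-≤ tA tB ⟩
    # (_⊆? A) E + # (_⊆? B) E             ≤⟨ #⊆-supermodular A B E ⟩
    # (_⊆? (A ∪ B)) E + # (_⊆? (A ∩ B)) E ≤⟨ +-monoʳ-≤ (# (_⊆? (A ∪ B)) E) (hyp (A ∩ B)) ⟩
    # (_⊆? (A ∪ B)) E + # (_∈? (A ∩ B)) M ∎)
    where open ≤-Reasoning

  -- Folds `tight-∪` over the vertices of `e` found in `vs`, starting from the empty set, which is
  -- tight because no head lies in it.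
  tight-⊇ : ∀ E M → HakimiCondition E M → ∀ e vs →
    (∀ v → v ∈ e → ∃ λ X → v ∈ X × # (_∈? X) M ≤ # (_⊆? X) E) →
    ∃ λ X → (∀ v → v ∈ˡ vs → v ∈ e → v ∈ X) × # (_∈? X) M ≤ # (_⊆? X) E
  tight-⊇ E M hyp e [] tight = ⊥ , (λ _ ()) , ≤-trans (≤-reflexive (#-none (_∈? ⊥) (λ _ → ∉⊥) M)) z≤n
  tight-⊇ E M hyp e (v ∷ vs) tight with tight-⊇ E M hyp e vs tight | v ∈? e
  ... | X , ⊇ , tX | no v∉e  = X , (λ { _ (here refl) v∈e → contradiction v∈e v∉e ; w (there w∈) → ⊇ w w∈ }) , tX
  ... | X , ⊇ , tX | yes v∈e with Y , v∈Y , tY ← tight v v∈e =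
    X ∪ Y , (λ { _ (here refl) _ → q⊆p∪q X Y v∈Y ; w (there w∈) w∈e → p⊆p∪q Y (⊇ w w∈ w∈e) }) , tight-∪ E M hyp X Y tX tY

  -- If every vertex of `e` lay in a set tight for `E`, the union of these sets would be tight and
  -- contain `e`, so counting `e` as well would violate the condition there.
  head-exists : ∀ e E M → HakimiCondition (e ∷ E) M →
    ∃ λ v → v ∈ e × (∀ X → v ∈ X → # (_⊆? X) E < # (_∈? X) M)
  head-exists e E M hyp
    with any? (λ v → (v ∈? e) ×-dec ¬? (anySubset? (λ X → (v ∈? X) ×-dec (# (_∈? X) M ≤? # (_⊆? X) E))))
  ... | yes (v , v∈e , ¬tight) = v , v∈e , λ X v∈X → ≰⇒> (λ tX → ¬tight (X , v∈X , tX))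
  ... | no ¬free = contradiction (≤-trans (hyp X) tX) (<⇒≱ (≤-reflexive (sym (#-yes (_⊆? X) E (λ {_} → e⊆X)))))
    where
    hyp′ : HakimiCondition E M
    hyp′ X = ≤-trans (#-∷-≤ (λ e → e ⊆? X) e E) (hyp X)
    tight : ∀ v → v ∈ e → ∃ λ X → v ∈ X × # (_∈? X) M ≤ # (_⊆? X) E
    tight v v∈e = decidable-stable (anySubset? (λ X → (v ∈? X) ×-dec (# (_∈? X) M ≤? # (_⊆? X) E)))
      (λ ¬tight → ¬free (v , v∈e , ¬tight))
    union = tight-⊇ E M hyp′ e (allFin n) tight
    X = proj₁ union
    tX = proj₂ (proj₂ union)
    e⊆X : e ⊆ X
    e⊆X {v} = proj₁ (proj₂ union) v (∈-allFin v)

  -- At the singleton of `v` the strict inequality forces at least one demanded head.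
  head-demanded : ∀ (E : Edges n) M {v : Fin n} → (∀ X → v ∈ X → # (_⊆? X) E < # (_∈? X) M) → v ∈ˡ M
  head-demanded E M {v} free
    with w , w∈M , w∈⁅v⁆ , _ ← #-<-witness never? (_∈? ⁅ v ⁆) M
      (≤-<-trans (≤-reflexive (#-none never? (λ _ ()) M)) (≤-<-trans z≤n (free ⁅ v ⁆ (x∈⁅x⁆ v))))
    = subst (_∈ˡ M) (x∈⁅y⁆⇒x≡y v w∈⁅v⁆) w∈M

  -- Sets containing `v` pay for the lost unit of demand out of their strict slack; all other sets
  -- keep their demand.
  HakimiCondition-step : ∀ (e : Subset n) E {M M′ v} → HakimiCondition (e ∷ E) M →
    (∀ X → v ∈ X → # (_⊆? X) E < # (_∈? X) M) → M ↭ v ∷ M′ → HakimiCondition E M′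
  HakimiCondition-step e E {M} {M′} {v} hyp free M↭ X with v ∈? X
  ... | yes v∈X = ≤-pred (≤-trans (free X v∈X) (≤-reflexive (≡.trans (#-↭ (_∈? X) M↭) (#-yes (_∈? X) M′ v∈X))))
  ... | no  v∉X = begin
    # (_⊆? X) E       ≤⟨ #-∷-≤ (_⊆? X) e E ⟩
    # (_⊆? X) (e ∷ E) ≤⟨ hyp X ⟩
    # (_∈? X) M       ≡⟨ ≡.trans (#-↭ (_∈? X) M↭) (#-no (_∈? X) M′ v∉X) ⟩
    # (_∈? X) M′      ∎
    where open ≤-Reasoning

  -- Hakimi's theorem by induction on the edges: each edge takes a safe head, which is struck from
  -- the demand. Equal lengths make the demand run out together with the edges.
  orient : ∀ E M → HakimiCondition E M → length E ≡ length M → ∃ λ D → map edge D ≡ E × map head D ↭ M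
  orient []      []  hyp _ = [] , refl , refl
  orient (e ∷ E) M   hyp eq
    with v , v∈e , free ← head-exists e E M hyp
    with M′ , M↭ ← ∈⇒↭∷ {xs = M} (head-demanded E M free)
    with D , D≡ , D↭ ← orient E M′ (HakimiCondition-step e E hyp free M↭) (suc-injectiveℕ (≡.trans eq (↭-length M↭)))
       = arc e v v∈e ∷ D , cong (e ∷_) D≡ , trans (prep v D↭) (↭-sym M↭)

-- Edmonds' branching theorem

  Entering : Subset n → Arc n → Set
  Entering X a = head a ∈ X × edge a ⊈ X

  entering? : ∀ X → Decidable (Entering X)
  entering? X a = (head a ∈? X) ×-dec ¬? (edge a ⊆? X)

  -- The in-degree of a vertex set, the cut function of Edmonds' theorem.
  ρ : Subset n → List (Arc n) → ℕ
  ρ X = # (entering? X)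

  -- An arc entering the intersection has its head in both sets and sticks out of at least one; an
  -- arc entering the union sticks out of both and has its head in at least one.
  ρ-submodular : ∀ A B R → ρ (A ∩ B) R + ρ (A ∪ B) R ≤ ρ A R + ρ B R
  ρ-submodular A B = #-submodular (entering? (A ∩ B)) (entering? (A ∪ B)) (entering? A) (entering? B) enters-∩ enters-∪ enters-both
    where
    enters-∩ : ∀ a → Entering (A ∩ B) a → Entering A a ⊎ Entering B a
    enters-∩ a (h∈ , e⊈) with edge a ⊆? A | edge a ⊆? B
    ... | no e⊈A  | _       = inj₁ (p∩q⊆p A B h∈ , e⊈A)
    ... | yes _   | no e⊈B  = inj₂ (p∩q⊆q A B h∈ , e⊈B)
    ... | yes e⊆A | yes e⊆B = contradiction (λ {_} x∈ → x∈p∩q⁺ (e⊆A x∈ , e⊆B x∈)) e⊈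
    ⊈A : ∀ {p} → p ⊈ A ∪ B → p ⊈ A
    ⊈A p⊈ p⊆A = p⊈ (λ x∈ → p⊆p∪q B (p⊆A x∈))
    ⊈B : ∀ {p} → p ⊈ A ∪ B → p ⊈ B
    ⊈B p⊈ p⊆B = p⊈ (λ x∈ → q⊆p∪q A B (p⊆B x∈))
    enters-∪ : ∀ a → Entering (A ∪ B) a → Entering A a ⊎ Entering B a
    enters-∪ a (h∈ , e⊈) with x∈p∪q⁻ A B h∈
    ... | inj₁ h∈A = inj₁ (h∈A , ⊈A e⊈)
    ... | inj₂ h∈B = inj₂ (h∈B , ⊈B e⊈)
    enters-both : ∀ a → Entering (A ∩ B) a → Entering (A ∪ B) a → Entering A a × Entering B a
    enters-both a (h∈ , _) (_ , e⊈) = (p∩q⊆p A B h∈ , ⊈A e⊈) , (p∩q⊆q A B h∈ , ⊈B e⊈)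

  module Branching (r : Fin n) where

    -- Edmonds' cut condition for `j` disjoint branchings rooted at `r`.
    RootConnected : ℕ → List (Arc n) → Set
    RootConnected j R = ∀ X → Nonempty X → r ∉ X → j ≤ ρ X R

    Within : List (Fin n) → Subset n → Set
    Within W X = Nonempty X × (∀ x → x ∈ X → x ∈ˡ W)

    -- W lists the vertices not yet reached by the growing branching, R the arcs still unused.
    module _ (j : ℕ) (R : List (Arc n)) (conn : RootConnected j R)
             (W : List (Fin n)) (w₀∈W : ∃ (_∈ˡ W))
             (surplus : ∀ X → Within W X → suc j ≤ ρ X R) where

      -- The full set is admitted as a starting point; any proper refinement of it avoids r.
      Critical : Subset n → Set
      Critical A = (∀ x → x ∈ A) ⊎ (r ∉ A × ρ A R ≤ j)

      -- If `A` is full the intersection is `B`. Otherwise the union avoids `r` and has at least `j`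
      -- entering arcs, so submodularity leaves at most `j` for the intersection.
      critical-∩ : ∀ {A B} → Critical A → r ∉ B → ρ B R ≤ j → Nonempty B → Critical (A ∩ B)
      critical-∩ {A} {B} (inj₁ full) r∉B tB _ = inj₂ (r∉B ∘ p∩q⊆q A B , subst (λ X → ρ X R ≤ j) (sym A∩B≡B) tB)
        where
        A∩B≡B : A ∩ B ≡ B
        A∩B≡B = ⊆-antisym (p∩q⊆q A B) (λ x∈B → x∈p∩q⁺ (full _ , x∈B))
      critical-∩ {A} {B} (inj₂ (r∉A , tA)) r∉B tB (b , b∈B) = inj₂ (r∉A ∘ p∩q⊆p A B , +-cancelʳ-≤ j _ _ (begin
        ρ (A ∩ B) R + j           ≤⟨ +-monoʳ-≤ (ρ (A ∩ B) R) (conn (A ∪ B) (b , q⊆p∪q A B b∈B) ([ r∉A , r∉B ]′ ∘ x∈p∪q⁻ A B)) ⟩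
        ρ (A ∩ B) R + ρ (A ∪ B) R ≤⟨ ρ-submodular A B R ⟩
        ρ A R + ρ B R             ≤⟨ +-mono-≤ tA tB ⟩
        j + j                     ∎))
        where open ≤-Reasoning

      critical-ρ : ∀ {A} → Critical A → ρ A R ≤ j
      critical-ρ (inj₁ full)     = ≤-trans (≤-reflexive (#-none (entering? _) (λ a (_ , e⊈) → e⊈ (λ {x} _ → full x)) R)) z≤n
      critical-ρ (inj₂ (_ , tA)) = tA

      -- Such an arc extends the branching to a new vertex. The last condition says that it enters
      -- no tight set, so that taking it away preserves `RootConnected j`.
      Removable : Arc n → Set
      Removable a = a ∈ˡ R × head a ∈ˡ W × (∃ λ w → w ∈ edge a × w ∉ˡ W) ×
                    (∀ B → Nonempty B → r ∉ B → ρ B R ≤ j → ¬ Entering B a)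

      inW? : Decidable (_∈ˡ W)
      inW? x = mem? _≟_ x W

      Frontier : Subset n → Subset n
      Frontier A = A ∩ comprehension inW?

      -- If a tight B blocks an arc that ends in W, starts outside W and lies inside A,
      -- then A ∩ B is critical and smaller.
      removable : ∀ A → Acc _<_ ∣ A ∣ → (∃ λ x → x ∈ A × x ∈ˡ W) → Critical A → ∃ Removable
      removable A (acc rec) (x , x∈A , x∈W) crit
        -- At most `j` arcs enter `A`, but more than `j` enter its part in `W`. Some arc thus enters
        -- that part without entering `A`; as its head is in `A`, its edge lies inside `A`.
        with a , a∈R , (h∈ , e⊈) , ¬enters ← #-<-witness (entering? A) (entering? (Frontier A)) R
               (≤-<-trans (critical-ρ crit) (surplus (Frontier A)
                 ((x , x∈p∩q⁺ (x∈A , ∈-comprehension⁺ inW? x∈W)) ,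
                 λ _ → ∈-comprehension⁻ inW? ∘ p∩q⊆q A _)))
        with h∈A , h∈W ← (p∩q⊆p A _ h∈ , ∈-comprehension⁻ inW? (p∩q⊆q A _ h∈))
        with w , w∈e , w∉ ← ⊈⇒∃ e⊈
        with anySubset? (λ B → nonempty? B ×-dec ¬? (r ∈? B) ×-dec (ρ B R ≤? j) ×-dec entering? B a)
      ... | no none = a , a∈R , h∈W , (w , w∈e , w∉W) , λ B ne r∉B tB ent → none (B , ne , r∉B , tB , ent)
        where
        e⊆A : edge a ⊆ A
        e⊆A = decidable-stable (edge a ⊆? A) (λ e⊈A → ¬enters (h∈A , e⊈A))
        w∉W : w ∉ˡ W
        w∉W w∈W = w∉ (x∈p∩q⁺ (e⊆A w∈e , ∈-comprehension⁺ inW? w∈W))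
      ... | yes (B , ne , r∉B , tB , h∈B , e⊈B) =
        removable (A ∩ B) (rec (p⊂q⇒∣p∣<∣q∣ A∩B⊂A)) (head a , x∈p∩q⁺ (h∈A , h∈B) , h∈W) (critical-∩ crit r∉B tB ne)
        where
        A∩B⊂A : A ∩ B ⊂ A
        -- The edge of `a` lies inside `A` and sticks out of `B`, so one of its vertices is lost.
        A∩B⊂A with y , y∈e , y∉B ← ⊈⇒∃ e⊈B =
          p∩q⊆p A B , y , decidable-stable (edge a ⊆? A) (λ e⊈A → ¬enters (h∈A , e⊈A)) y∈e , y∉B ∘ p∩q⊆q A B

      removableArc : ∃ Removable
      removableArc = removable ⊤ (<-wellFounded _) (proj₁ w₀∈W , ∈⊤ , proj₂ w₀∈W) (inj₁ (λ _ → ∈⊤))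

    module Step {a : Arc n} {R R₁ : List (Arc n)} (R↭ : R ↭ a ∷ R₁) {W W₁ : List (Fin n)} (W↭ : W ↭ head a ∷ W₁) where

      -- A set entered by `a` is not tight, so it can spare one arc.
      rootConnected : ∀ {j} → RootConnected j R → (∀ B → Nonempty B → r ∉ B → ρ B R ≤ j → ¬ Entering B a) →
        RootConnected j R₁
      rootConnected conn safe X ne r∉X with entering? X a
      ... | no ¬ent = ≤-trans (conn X ne r∉X) (≤-reflexive (≡.trans (#-↭ (entering? X) R↭) (#-no (entering? X) {a} R₁ ¬ent)))
      ... | yes ent = ≤-pred (≤-trans (≰⇒> (λ tX → safe X ne r∉X tX ent))
                        (≤-reflexive (≡.trans (#-↭ (entering? X) R↭) (#-yes (entering? X) {a} R₁ ent))))

      -- A set within `W₁` misses the head of `a`, hence does not lose an entering arc.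
      surplus : ∀ {j} → head a ∉ˡ W₁ → (∀ X → Within W X → suc j ≤ ρ X R) → ∀ X → Within W₁ X → suc j ≤ ρ X R₁
      surplus h∉ surplus X (ne , ⊆W₁) =
        ≤-trans (surplus X (ne , λ x x∈X → ∈-resp-↭ (↭-sym W↭) (there (⊆W₁ x x∈X))))
          (≤-reflexive (≡.trans (#-↭ (entering? X) R↭) (#-no (entering? X) {a} R₁ (λ (h∈X , _) → h∉ (⊆W₁ _ h∈X)))))

      -- A set within `W` that contains the head of `a` is entered by `a`, because `w` lies outside;
      -- any other such set already lies within `W₁`.
      enters : ∀ {F w} → w ∈ edge a → w ∉ˡ W →
        (∀ X → Within W₁ X → ∃ λ b → b ∈ˡ F × Entering X b) →
        ∀ X → Within W X → ∃ λ b → b ∈ˡ (a ∷ F) × Entering X b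
      enters {w = w} w∈e w∉W enters X (ne , ⊆W) with head a ∈? X
      ... | yes h∈X = a , here refl , h∈X , λ e⊆X → w∉W (⊆W w (e⊆X w∈e))
      ... | no  h∉X with b , b∈F , ent ← enters X
                          (ne , λ x x∈X → Any.tail (λ { refl → h∉X x∈X }) (∈-resp-↭ W↭ (⊆W x x∈X)))
                      = b , there b∈F , ent

    -- Lovász's induction on the number of unreached vertices. The invariant reserves `j` arcs into
    -- every nonempty set avoiding `r` for later branchings, and one more into sets of unreached
    -- vertices for the current branching.
    grow : ∀ m W R j → length W ≡ m → Unique W → RootConnected j R → (∀ X → Within W X → suc j ≤ ρ X R) →
      ∃₂ λ F R′ → R ↭ F ++ R′ × map head F ↭ W × RootConnected j R′ ×
        (∀ X → Within W X → ∃ λ a → a ∈ˡ F × Entering X a)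
    grow zero    []         R j _  _ conn _ =
      [] , R , refl , refl , conn , λ X ((x , x∈X) , ⊆W) → contradiction (⊆W x x∈X) λ ()
    grow (suc m) W@(w₀ ∷ _) R j eq uniq conn surplus
      with a , a∈R , h∈W , (w , w∈e , w∉W) , safe ← removableArc j R conn W (w₀ , here refl) surplus
      with R₁ , R↭ ← ∈⇒↭∷ a∈R
      with W₁ , W↭ ← ∈⇒↭∷ h∈W
      with h∉ ∷ uniq₁ ← Unique-resp-↭ W↭ uniq
      with F , R₂ , R₁↭ , F↭ , conn₂ , enters ← grow m W₁ R₁ j
             (suc-injectiveℕ (≡.trans (sym (↭-length W↭)) eq)) uniq₁
             (Step.rootConnected R↭ W↭ conn safe)
             (Step.surplus R↭ W↭ (λ h∈W₁ → All.lookup h∉ h∈W₁ refl) surplus)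
      = a ∷ F , R₂ , trans R↭ (prep a R₁↭) , trans (prep (head a) F↭) (↭-sym W↭) , conn₂ , Step.enters R↭ W↭ w∈e w∉W enters

-- Branchings are trees

  meetsTwo⁺ : ∀ {t} (p : Fin n → Fin t) {e u v} → u ∈ e → v ∈ e → p u ≢ p v → T (meetsTwo p e)
  meetsTwo⁺ p {e} {u} {v} u∈e v∈e pu≢pv =
    any⁺ _ (lose (∈-allFin u) (any⁺ _ (lose (∈-allFin v) (Equivalence.from T-∧
      (Equivalence.from T-≡ ([]=⇒lookup u∈e) , Equivalence.from T-∧
      (Equivalence.from T-≡ ([]=⇒lookup v∈e) , fromWitnessFalse pu≢pv))))))

  EntersAllAvoiding : Fin n → List (Arc n) → Set
  EntersAllAvoiding r F = ∀ X → Nonempty X → r ∉ X → ∃ λ a → a ∈ˡ F × Entering X a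

  -- Each part other than that of `r` is entered by some arc, whose edge then meets two parts.
  -- Different parts get different arcs, since the heads lie in different parts.
  branching⇒connected : ∀ r F → EntersAllAvoiding r F → PartitionConnected (map edge F)
  branching⇒connected r F enters t p surj = ≤-trans
    (count-≥ (meetsTwo p ∘ edge) (p ∘ head) (p r) F crossing)
    (≤-reflexive (sym (count-map (meetsTwo p) edge F)))
    where
    crossing : ∀ i → i ≢ p r → ∃ λ a → a ∈ˡ F × T (meetsTwo p (edge a)) × p (head a) ≡ i
    crossing i i≢pr
      with u , pu≡i ← surj i
      with a , a∈F , h∈ , e⊈ ← enters (comprehension (λ v → p v ≟ i))
             (u , ∈-comprehension⁺ (λ v → p v ≟ i) (pu≡i refl))
             (i≢pr ∘ sym ∘ ∈-comprehension⁻ (λ v → p v ≟ i))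
      with w , w∈e , w∉ ← ⊈⇒∃ e⊈
      with refl ← ∈-comprehension⁻ (λ v → p v ≟ i) h∈
      = a , a∈F , meetsTwo⁺ p (head∈edge a) w∈e (w∉ ∘ ∈-comprehension⁺ (λ v → p v ≟ i) ∘ sym) , refl

  -- The partition into singletons already requires `n ∸ 1` edges, so none can be removed.
  connected∧size⇒tree : ∀ T → PartitionConnected T → length T ≡ n ∸ 1 → IsTree T
  connected∧size⇒tree T conn size = conn , λ i conn′ → <-irrefl refl (begin-strict
    n ∸ 1                                        ≤⟨ conn′ n id (λ i → i , id) ⟩
    count (meetsTwo id) (removeAt T i)           ≤⟨ count≤length (meetsTwo id) (removeAt T i) ⟩
    length (removeAt T i)                        <⟨ ≤-reflexive (sym (length-removeAt′ T i)) ⟩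
    length T                                     ≡⟨ size ⟩
    n ∸ 1                                        ∎)
    where open ≤-Reasoning

  -- Packing edge-disjoint branchings

  module _ (r : Fin n) (W : List (Fin n)) (uniq : Unique W) (r∉W : r ∉ˡ W) (≢r⇒∈W : ∀ x → x ≢ r → x ∈ˡ W)
           (length-W : length W ≡ n ∸ 1) where
    open Branching r
    open PermutationReasoning

    length-spanning : ∀ F → map head F ↭ W → length (map edge F) ≡ n ∸ 1
    length-spanning F F↭ =
      ≡.trans (length-map edge F) (≡.trans (sym (length-map head F)) (≡.trans (↭-length F↭) length-W))

    -- Sets within `W` avoid `r`, so the condition for `suc j` supplies both invariants of `grow`.
    -- Each round uses up one copy of `W` among the heads, and the heads in `M` remain at the end.
    packBranchings : ∀ j R {M} → map head R ↭ concat (replicate j W) ++ M → RootConnected j R →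
      ∃₂ λ (Ts : Vec (Edges n) j) R′ →
        map edge R ↭ concat (toList Ts) ++ map edge R′ × All IsTree (toList Ts) × map head R′ ↭ M
    packBranchings zero    R R↭ conn = [] , R , refl , [] , R↭
    packBranchings (suc j) R {M} R↭ conn
      with F , R₁ , R↭FR₁ , F↭ , conn₁ , enters ← grow (length W) W R j refl uniq
             (λ X ne r∉X → ≤-trans (n≤1+n j) (conn X ne r∉X))
             (λ X (ne , ⊆W) → conn X ne (r∉W ∘ ⊆W r))
      with Ts , R₂ , R₁↭ , trees , R₂↭ ← packBranchings j R₁ {M} (++-cancelˡ-↭ W (begin
             W ++ map head R₁                        ↭⟨ ++⁺ʳ (map head R₁) F↭ ⟨
             map head F ++ map head R₁               ≡⟨ map-++ head F R₁ ⟨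
             map head (F ++ R₁)                      ↭⟨ map⁺ head R↭FR₁ ⟨
             map head R                              ↭⟨ R↭ ⟩
             (W ++ concat (replicate j W)) ++ M      ≡⟨ ++-assoc W _ M ⟩
             W ++ (concat (replicate j W) ++ M)      ∎)) conn₁
      = map edge F ∷ Ts , R₂ , (begin
          map edge R                                       ↭⟨ map⁺ edge R↭FR₁ ⟩
          map edge (F ++ R₁)                               ≡⟨ map-++ edge F R₁ ⟩
          map edge F ++ map edge R₁                        ↭⟨ ++⁺ˡ (map edge F) R₁↭ ⟩
          map edge F ++ (concat (toList Ts) ++ map edge R₂) ≡⟨ ++-assoc (map edge F) _ _ ⟨
          (map edge F ++ concat (toList Ts)) ++ map edge R₂ ∎)
        , connected∧size⇒tree (map edge F)
            (branching⇒connected r F λ X ne r∉X → enters X (ne , λ x x∈X → ≢r⇒∈W x (λ { refl → r∉X x∈X })))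
            (length-spanning F F↭)
          ∷ trees , R₂↭

-- Maps

  -- Indexed by positions in the edge list, so that it can serve as the tail function of `IsMap`.
  headAt : ∀ (D : List (Arc n)) → Fin (length (map edge D)) → Fin n
  headAt (a ∷ D) zero    = head a
  headAt (a ∷ D) (suc i) = headAt D i

  headAt∈ : ∀ D i → headAt D i ∈ lookup (map edge D) i
  headAt∈ (a ∷ D) zero    = head∈edge a
  headAt∈ (a ∷ D) (suc i) = headAt∈ D i

  headAt-∈ˡ : ∀ D i → headAt D i ∈ˡ map head D
  headAt-∈ˡ (a ∷ D) zero    = here refl
  headAt-∈ˡ (a ∷ D) (suc i) = there (headAt-∈ˡ D i)

  headAt-surjective : ∀ D {v} → v ∈ˡ map head D → ∃ λ i → headAt D i ≡ v
  headAt-surjective (a ∷ D) (here refl) = zero , refl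
  headAt-surjective (a ∷ D) (there v∈) with i , eq ← headAt-surjective D v∈ = suc i , eq

  headAt-injective : ∀ D → Unique (map head D) → ∀ i j → headAt D i ≡ headAt D j → i ≡ j
  headAt-injective (a ∷ D) _          zero    zero    _  = refl
  headAt-injective (a ∷ D) (h∉ ∷ _)   zero    (suc j) eq = contradiction eq (All.lookup h∉ (headAt-∈ˡ D j))
  headAt-injective (a ∷ D) (h∉ ∷ _)   (suc i) zero    eq = contradiction (sym eq) (All.lookup h∉ (headAt-∈ˡ D i))
  headAt-injective (a ∷ D) (_ ∷ uniq) (suc i) (suc j) eq = cong suc (headAt-injective D uniq i j eq)

  heads≡allFin⇒map : ∀ D → map head D ≡ allFin n → IsMap (map edge D)
  heads≡allFin⇒map D eq = headAt D , headAt∈ D , λ v →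
    let i , i≡v = headAt-surjective D (subst (v ∈ˡ_) (sym eq) (∈-allFin v))
    in i , i≡v , λ j j≡v → headAt-injective D (subst Unique (sym eq) (Unique.allFin⁺ n)) j i (≡.trans j≡v (sym i≡v))

  open PermutationReasoning

  -- The arcs are reordered until their heads read as consecutive copies of `allFin n`; each block
  -- of arcs over one copy is a map.
  splitMaps : ∀ j D → map head D ↭ concat (replicate j (allFin n)) → IsJMap j (map edge D)
  splitMaps zero    []      _  = [] , refl , []
  splitMaps zero    (_ ∷ _) D↭ with () ← ↭-length D↭
  splitMaps (suc j) D D↭
    with D′ , eq , D↭D′ ← ↭-map-inv head D↭
    with D₁ , D₂ , refl , eq₁ , eq₂ ← map≡++⁻ head D′ {allFin n} (sym eq)
    with Ms , Ms↭ , maps ← splitMaps j D₂ (↭-reflexive eq₂)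
    = map edge D₁ ∷ Ms , (begin
        map edge D₁ ++ concat (toList Ms) ↭⟨ ++⁺ˡ (map edge D₁) Ms↭ ⟩
        map edge D₁ ++ map edge D₂        ≡⟨ map-++ edge D₁ D₂ ⟨
        map edge (D₁ ++ D₂)               ↭⟨ map⁺ edge D↭D′ ⟨
        map edge D                        ∎)
      , heads≡allFin⇒map D₁ eq₁ ∷ maps

-- Indegrees realising a tight hypergraph

-- Proved together with the next count: `allFin` without vertex zero is `tabulate suc`, which
-- reindexes to a smaller `allFin`.
#-tabulate-suc : ∀ {n} b (X : Subset n) → # (_∈? (b ∷ X)) (tabulate suc) ≡ ∣ X ∣
#-allFin : ∀ {n} (X : Subset n) → # (_∈? X) (allFin n) ≡ ∣ X ∣

#-tabulate-suc b X = begin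
  # (_∈? (b ∷ X)) (tabulate suc)         ≡⟨ cong (# (_∈? (b ∷ X))) (map-tabulate id suc) ⟨
  # (_∈? (b ∷ X)) (map suc (allFin _))   ≡⟨ count-map (λ v → ⌊ v ∈? (b ∷ X) ⌋) suc (allFin _) ⟩
  # (λ v → suc v ∈? (b ∷ X)) (allFin _)  ≡⟨ ≤-antisym (#-mono _ (_∈? X) (λ _ → drop-there) (allFin _)) (#-mono (_∈? X) _ (λ _ → there) (allFin _)) ⟩
  # (_∈? X) (allFin _)                   ≡⟨ #-allFin X ⟩
  ∣ X ∣                                  ∎
  where open ≡.≡-Reasoning

#-allFin []            = refl
#-allFin (inside  ∷ X) = ≡.trans (#-yes (_∈? (inside ∷ X)) (tabulate suc) here) (cong suc (#-tabulate-suc inside X))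
#-allFin (outside ∷ X) = ≡.trans (#-no (_∈? (outside ∷ X)) {zero} (tabulate suc) λ ()) (#-tabulate-suc outside X)

length-copies : ∀ {A : Set} j (xs : List A) → length (concat (replicate j xs)) ≡ j * length xs
length-copies zero    xs = refl
length-copies (suc j) xs = ≡.trans (length-++ xs) (cong (length xs +_) (length-copies j xs))

module _ (k ℓ n : ℕ) (ℓ≤k : ℓ ≤ k) where

  nonroots : List (Fin (suc n))
  nonroots = tabulate suc

  -- Vertex zero is the root, with indegree `k ∸ ℓ`; every other vertex has indegree `k`. The first
  -- `ℓ` blocks are the heads of the branchings, the others those of the maps.
  demand : List (Fin (suc n))
  demand = concat (replicate ℓ nonroots) ++ concat (replicate (k ∸ ℓ) (allFin (suc n)))

  ℓ*m+[k∸ℓ]*m : ∀ m → ℓ * m + (k ∸ ℓ) * m ≡ k * m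
  ℓ*m+[k∸ℓ]*m m = ≡.trans (sym (*-distribʳ-+ m ℓ (k ∸ ℓ))) (cong (_* m) (m+[n∸m]≡n ℓ≤k))

  ℓ*m+[k∸ℓ]*1+m : ∀ m → (ℓ * m + (k ∸ ℓ) * suc m) + ℓ ≡ k * suc m
  ℓ*m+[k∸ℓ]*1+m m = begin
    (ℓ * m + (k ∸ ℓ) * suc m) + ℓ ≡⟨ xy∙z≈xz∙y (ℓ * m) _ ℓ ⟩
    (ℓ * m + ℓ) + (k ∸ ℓ) * suc m ≡⟨ cong (_+ (k ∸ ℓ) * suc m) (≡.trans (+-comm (ℓ * m) ℓ) (sym (*-suc ℓ m))) ⟩
    ℓ * suc m + (k ∸ ℓ) * suc m   ≡⟨ ℓ*m+[k∸ℓ]*m (suc m) ⟩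
    k * suc m                     ∎
    where open ≡.≡-Reasoning

  #-demand : ∀ b X → # (_∈? (b ∷ X)) demand ≡ ℓ * ∣ X ∣ + (k ∸ ℓ) * ∣ b ∷ X ∣
  #-demand b X = begin
    # (_∈? (b ∷ X)) demand ≡⟨ #-++ (_∈? (b ∷ X)) (concat (replicate ℓ nonroots)) _ ⟩
    _                      ≡⟨ cong₂ _+_ (#-copies (_∈? (b ∷ X)) ℓ nonroots) (#-copies (_∈? (b ∷ X)) (k ∸ ℓ) (allFin (suc n))) ⟩
    _                      ≡⟨ cong₂ (λ x y → ℓ * x + (k ∸ ℓ) * y) (#-tabulate-suc b X) (#-allFin (b ∷ X)) ⟩
    ℓ * ∣ X ∣ + (k ∸ ℓ) * ∣ b ∷ X ∣ ∎
    where open ≡.≡-Reasoning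

  #-demand-avoiding : ∀ X → zero ∉ X → # (_∈? X) demand ≡ k * ∣ X ∣
  #-demand-avoiding (inside  ∷ X) 0∉X = contradiction here 0∉X
  #-demand-avoiding (outside ∷ X) _   = ≡.trans (#-demand outside X) (ℓ*m+[k∸ℓ]*m ∣ X ∣)

  -- Only the root can fall short of `k`, and its shortfall is `ℓ`.
  #-demand-≥ : ∀ X → k * ∣ X ∣ ≤ # (_∈? X) demand + ℓ
  #-demand-≥ (inside  ∷ X) = ≤-reflexive (sym (≡.trans (cong (_+ ℓ) (#-demand inside X)) (ℓ*m+[k∸ℓ]*1+m ∣ X ∣)))
  #-demand-≥ (outside ∷ X) = ≤-trans (≤-reflexive (sym (#-demand-avoiding (outside ∷ X) λ ()))) (m≤m+n _ ℓ)

  length-demand : length demand + ℓ ≡ k * suc n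
  length-demand = begin
    length demand + ℓ                     ≡⟨ cong (_+ ℓ) (length-++ (concat (replicate ℓ nonroots))) ⟩
    _                                     ≡⟨ cong (_+ ℓ) (cong₂ _+_ (length-copies ℓ nonroots) (length-copies (k ∸ ℓ) (allFin (suc n)))) ⟩
    _                                     ≡⟨ cong₂ (λ x y → (ℓ * x + (k ∸ ℓ) * suc y) + ℓ) (length-tabulate suc) (length-tabulate suc) ⟩
    (ℓ * n + (k ∸ ℓ) * suc n) + ℓ         ≡⟨ ℓ*m+[k∸ℓ]*1+m n ⟩
    k * suc n                             ∎
    where open ≡.≡-Reasoning

  -- The `ℓ` in the sparsity bound covers the shortfall at the root; a set containing no edge
  -- satisfies the condition trivially.
  sparse⇒Hakimi : ∀ E → Sparse k ℓ E → HakimiCondition E demand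
  sparse⇒Hakimi E sparse X with # (_⊆? X) E | sparse X
  ... | zero  | _     = z≤n
  ... | suc m | bound = +-cancelʳ-≤ ℓ _ _ (≤-trans (bound (s≤s z≤n)) (#-demand-≥ X))

  -- A set avoiding the root contains `k * ∣ X ∣` heads. Each belongs to an edge inside the set or
  -- to an entering arc, and sparsity bounds the former.
  sparse⇒rootConnected : ∀ D → Sparse k ℓ (map edge D) → map head D ↭ demand →
    Branching.RootConnected zero ℓ D
  sparse⇒rootConnected D sparse heads X (x , x∈X) 0∉X = +-cancelˡ-≤ (# (_⊆? X) (map edge D)) _ _ (≤-trans ≤k∣X∣ k∣X∣≤)
    where
    open ≤-Reasoning
    k∣X∣≤ : k * ∣ X ∣ ≤ # (_⊆? X) (map edge D) + ρ X D
    k∣X∣≤ = begin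
      k * ∣ X ∣                               ≡⟨ #-demand-avoiding X 0∉X ⟨
      # (_∈? X) demand                        ≡⟨ #-↭ (_∈? X) heads ⟨
      # (_∈? X) (map head D)                  ≡⟨ count-map _ head D ⟩
      # (λ a → head a ∈? X) D                 ≤⟨ #-cover _ (λ a → edge a ⊆? X) (entering? X) inside-or-entering D ⟩
      # (λ a → edge a ⊆? X) D + ρ X D         ≡⟨ cong (_+ ρ X D) (count-map _ edge D) ⟨
      # (_⊆? X) (map edge D) + ρ X D          ∎
      where
      inside-or-entering : ∀ a → head a ∈ X → edge a ⊆ X ⊎ Entering X a
      inside-or-entering a h∈X with edge a ⊆? X
      ... | yes e⊆X = inj₁ e⊆X
      ... | no  e⊈X = inj₂ (h∈X , e⊈X)
    ≤k∣X∣ : # (_⊆? X) (map edge D) + ℓ ≤ k * ∣ X ∣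
    ≤k∣X∣ with # (_⊆? X) (map edge D) | sparse X
    ... | suc _ | bound = bound (s≤s z≤n)
    -- Sparsity is silent when no edge lies inside; here `ℓ ≤ k` and nonemptiness of `X` give the
    -- bound.
    ... | zero  | _     = ≤-trans ℓ≤k (≤-trans (≤-reflexive (sym (*-identityʳ k))) (*-monoʳ-≤ k (≤-trans (s≤s z≤n) (x∈p⇒∣p-x∣<∣p∣ x∈X))))

mainTheorem6 : (k ℓ s n : ℕ) (E : Edges n) →
    1 ≤ k → ℓ ≤ k → IsHypergraph E → Tight k ℓ E → HasDimension E s → ℓ < s * k →
    Σ (Edges n) λ E₁ → Σ (Edges n) λ E₂ →
    (E ↭ E₁ ++ E₂) × IsArborescence ℓ E₁ × IsJMap (k ∸ ℓ) E₂
-- Without vertices there is no root to choose. Both cases are impossible: some edge must attain the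
-- dimension, and an edge must contain a vertex.
mainTheorem6 k ℓ s zero    []      _ _ _ _ (_ , ()) _
mainTheorem6 k ℓ s zero    (e ∷ E) _ _ ((() , _) ∷ _) _ _ _
mainTheorem6 k ℓ s (suc n) E _ ℓ≤k _ (sparse , size) _ _
  -- Tightness gives `E` exactly the length of the demand.
  with D , refl , heads ← orient E (demand k ℓ n ℓ≤k) (sparse⇒Hakimi k ℓ n ℓ≤k E sparse)
         (+-cancelʳ-≡ ℓ _ _ (≡.trans size (sym (length-demand k ℓ n ℓ≤k))))
  -- Once the branchings from root zero are removed, the heads left over form `k ∸ ℓ` copies of the
  -- vertex set.
  with Ts , R , E↭ , trees , R↭ ← packBranchings zero (tabulate suc) (Unique.tabulate⁺ suc-injective)
         (λ 0∈ → case ∈-tabulate⁻ 0∈ of λ ())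
         (λ { zero 0≢0 → contradiction refl 0≢0 ; (suc i) _ → ∈-tabulate⁺ i })
         (length-tabulate suc) ℓ D heads (sparse⇒rootConnected k ℓ n ℓ≤k D sparse heads)
  = concat (toList Ts) , map edge R , E↭ , (Ts , refl , trees) , splitMaps (k ∸ ℓ) R R↭
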